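{- Let $k\geq 2$ and let $T$ be a knockout tournament whose players are the elements of $GF(2^k)$ such that $v_T(x,y)=1+d(x-y)$ for all distinct $x,y\in GF(2^k)$. For each nonzero $z\in GF(2^k)$, let $T(z)$ be the knockout tournament obtained from $T$ by replacing each player $x$ with $zx$. Then $$\mathcal{T}:=\{T(z): z\text{ a nonzero element of } GF(2^k)\}$$ is a stable Serial Knockout Competition.
   Context: Knockout tournaments. A (balanced) knockout tournament $T$ on $n=2^k$ players is given by a seeding, i.e. an ordering $s=s_0s_1\cdots s_{n-1}$ of the players assigned from left to right to the leaves of a complete binary tree of depth $k$. In round $1$ the players in positions $2j$ and $2j+1$ meet; in each later round, the winners of the two subtrees below a node meet. For distinct players $x,x'$ we write $v_T(x,x')=i$ if $x,x'$ can meet in round $i$ of $T$ (assuming both win all earlier matches); equivalently, if $x,x'$ are in positions $p,p'$, then $i\in\{1,\ldots,k\}$ is the smallest integer with $\lfloor p/2^i\rfloor=\lfloor p'/2^i\rfloor$. Stability. A set $\mathcal{T}$ of knockout tournaments on the same $n=2^k$ players is stable in round $i$ if there is a number $c_i$ such that $\#\{T\in\mathcal{T}: v_T(x,x')=i\}=c_i$ for all pairs of distinct players $x,x'$. The set $\mathcal{T}$ is stable if it is stable in all rounds $i=1,\ldots,k$. A Serial Knockout Competition (SKC) for $n=2^k$ players is a competition consisting of $n-1$ knockout tournaments on these players. Galois field and degree. Fix an irreducible polynomial $q\in\mathbb{Z}_2[X]$ of degree $k$ and let $GF(2^k)=\mathbb{Z}_2[X]/(q)$, with $\alpha$ the class of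 $X$. Each element $x\in GF(2^k)$ is uniquely written as $x=\sum_{i=0}^{k-1}x_i\alpha^i$ with $x_i\in\{0,1\}$; for $x\neq 0$ its degree is $d(x)=\max\{i: x_i\neq 0\}$. A tournament $T$ with $v_T(x,y)=1+d(x-y)$ for all distinct $x,y$ exists; replacing each player $x$ by $zx$ means that the leaf occupied by $x$ in $T$ is occupied by $zx$ in $T(z)$. -}

module Defs where

open import Level using (Level; 0ℓ)
open import Algebra.Bundles using (RawSemiring)
import Algebra.Definitions.RawSemiring as SemiringDefs
open import Data.Bool using (Bool; true; false; _∧_; _xor_)
open import Data.Fin using (Fin; toℕ)
open import Data.List using (List; []; _∷_; map)
open import Data.Nat using (ℕ; zero; suc; _+_; _∸_; _*_; _^_; _/_; _≤_; _<_)
open import Data.Nat.Properties using (m^n≢0)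
open import Data.Product using (Σ; ∃; ∃-syntax; _×_; proj₁)
import Data.Vec as Vec
open Vec using (Vec; toList)
open import Function.Base using (_∘_)
open import Function.Bundles using (_↔_; Inverse; Bijection)
open import Relation.Binary.Bundles using (Setoid)
import Relation.Binary.Construct.On as On
open import Relation.Binary.PropositionalEquality using (_≡_; _≢_; setoid; _→-setoid_)
open import Relation.Nullary using (¬_)
open import Relation.Unary using (Pred)

private
  variable
    a ℓ : Level
    A : Set a
    k : ℕ

------------------------------------------------------------------------
-- Knockout tournaments

-- The leaves are numbered from left to right.
record Tournament (k : ℕ) (A : Set a) : Set a where
  field
    seeding : Fin (2 ^ k) ↔ A

  leaf : Fin (2 ^ k) → A
  leaf = Inverse.to seeding

  position : A → ℕ
  position x = toℕ (Inverse.from seeding x)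

open Tournament public

⌊_/2^_⌋ : ℕ → ℕ → ℕ
⌊ p /2^ i ⌋ = _/_ p (2 ^ i) {{m^n≢0 2 i}}

SameSubtree : Tournament k A → A → A → ℕ → Set
SameSubtree T x x' i = ⌊ position T x /2^ i ⌋ ≡ ⌊ position T x' /2^ i ⌋

-- The relation v_T(x,x') = i.
v⟨_⟩_,_≐_ : Tournament k A → A → A → ℕ → Set
v⟨_⟩_,_≐_ {k} T x x' i =
  1 ≤ i × i ≤ k × SameSubtree T x x' i ×
  (∀ j → 1 ≤ j → j < i → ¬ SameSubtree T x x' j)

-- Two tournaments are equal when they have the same seeding;
-- their position functions then agree as well.
tournamentSetoid : ℕ → Set a → Setoid a a
tournamentSetoid k A = On.setoid (Fin (2 ^ k) →-setoid A) (leaf {k = k})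

subsetSetoid : Pred (Tournament k A) ℓ → Setoid _ _
subsetSetoid {k = k} {A = A} 𝒯 = On.setoid (tournamentSetoid k A) (proj₁ {B = 𝒯})

-- 𝒯, counted up to equality of seedings, has exactly c elements.
#_≐_ : Pred (Tournament k A) ℓ → ℕ → Set _
# 𝒯 ≐ c = Bijection (setoid (Fin c)) (subsetSetoid 𝒯)

StableInRound : Pred (Tournament k A) ℓ → ℕ → Set _
StableInRound {A = A} 𝒯 i =
  ∃[ c ] ((x x' : A) → x ≢ x' → # (λ T → 𝒯 T × v⟨ T ⟩ x , x' ≐ i) ≐ c)

Stable : Pred (Tournament k A) ℓ → Set _
Stable {k = k} 𝒯 = ∀ i → 1 ≤ i → i ≤ k → StableInRound 𝒯 i

SKC : Pred (Tournament k A) ℓ → Set _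
SKC {k = k} 𝒯 = # 𝒯 ≐ (2 ^ k ∸ 1)

-- Replaced f T T': the leaf occupied by x in T is occupied by f x in T'.
-- Such a T' can exist only if f permutes the players, and is then unique.
Replaced : (A → A) → Tournament k A → Tournament k A → Set _
Replaced f T T' = ∀ p → leaf T' p ≡ f (leaf T p)

------------------------------------------------------------------------
-- ℤ₂[X], with ℤ₂ = (Bool, _xor_, _∧_)

-- Coefficients, constant term first; trailing zeros are allowed, so
-- equality of polynomials is _≈ₚ_.
Poly : Set
Poly = List Bool

coeff : Poly → ℕ → Bool
coeff []      _       = false
coeff (a ∷ _) zero    = a
coeff (_ ∷ f) (suc i) = coeff f i

_≈ₚ_ : Poly → Poly → Set
f ≈ₚ g = ∀ i → coeff f i ≡ coeff g i

infixl 6 _+ₚ_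
infixl 7 _*ₚ_

_+ₚ_ : Poly → Poly → Poly
[]      +ₚ g       = g
f       +ₚ []      = f
(a ∷ f) +ₚ (b ∷ g) = (a xor b) ∷ (f +ₚ g)

_*ₚ_ : Poly → Poly → Poly
[]      *ₚ g = []
(a ∷ f) *ₚ g = map (a ∧_) g +ₚ (false ∷ f *ₚ g)

polyRawSemiring : RawSemiring 0ℓ 0ℓ
polyRawSemiring = record
  { Carrier = Poly
  ; _≈_     = _≈ₚ_
  ; _+_     = _+ₚ_
  ; _*_     = _*ₚ_
  ; 0#      = []
  ; 1#      = true ∷ []
  }

open SemiringDefs polyRawSemiring public using (Irreducible)

HasDegree : Poly → ℕ → Set
HasDegree f d = coeff f d ≡ true × (∀ j → d < j → coeff f j ≡ false)

------------------------------------------------------------------------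
-- GF(2^k) = ℤ₂[X]/(q), q of degree k

-- x = Σ_{i<k} x_i α^i is represented by its coordinates (x_0,…,x_{k-1}),
-- that is, by the representative of its class of degree less than k.
GF : ℕ → Set
GF k = Vec Bool k

0F : GF k
0F = Vec.replicate _ false

-- Subtraction is addition, as the characteristic is 2.
infixl 6 _-F_
_-F_ : GF k → GF k → GF k
_-F_ = Vec.zipWith _xor_

-- The class of a polynomial of degree at most k: if the coefficient of
-- X^k is 1, subtract q. This needs q to have degree k.
reduce : Poly → Vec Bool (suc k) → GF k
reduce {k} q v =
  Vec.init v -F Vec.map (Vec.last v ∧_) (Vec.tabulate (coeff q ∘ toℕ))

-- The class of any polynomial, by [a + X f] = [a + X r] for r the
-- representative of [f].
class : Poly → Poly → GF k
class q []      = 0F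
class q (a ∷ f) = reduce q (a Vec.∷ class q f)

mulF : Poly → GF k → GF k → GF k
mulF q x y = class q (toList x *ₚ toList y)

-- The set { T(z) : z ≠ 0 }. That multiplication by z permutes the
-- players, so that T(z) exists, is not built in; it is needed for this
-- set to have 2^k - 1 elements.
multiples : Poly → Tournament k (GF k) → Pred (Tournament k (GF k)) 0ℓ
multiples q T T' = ∃[ z ] (z ≢ 0F × Replaced (mulF q z) T T')

-- The players x and x′ meet in T(z) as the players y and y′ with z y = x and
-- z y′ = x′ do in T, that is, in round 1 + d(w) for the w with z w = x − x′.
-- As z ranges over the nonzero elements, so does w, each value being taken
-- once; hence exactly 2^d of the tournaments T(z) have x meet x′ in round
-- 1 + d. All this only needs multiplication to be commutative, distributive
-- and free of zero divisors: on a finite field, division comes from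
-- injectivity. Absence of zero divisors is Euclid's lemma for q.

module Submission where

open import Level using (Level; 0ℓ)
open import Algebra.Bundles using (CommutativeSemiring; RawSemiring)
import Algebra.Definitions.RawSemiring as SemiringDefs
import Algebra.Properties.Semiring.Divisibility as SemiringDivisibility
open import Algebra.Structures.Biased using (isCommutativeSemiringˡ)
open import Data.Bool using (Bool; true; false; _∧_; _xor_)
open import Data.Bool.Properties
  using (xor-assoc; xor-comm; xor-identityʳ; xor-same; ∧-zeroʳ)
open import Data.Bool.Solver using (module xor-∧-Solver)
open import Data.Fin using (Fin; zero; suc; toℕ; punchIn; punchOut)
open import Data.Fin.Properties
  using (_≟_; any?; injective⇒≤; punchIn-injective; punchInᵢ≢i; punchIn-punchOut;
         punchOut-injective; *↔×; 2↔Bool)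
open import Data.List using ([]; _∷_; map)
open import Data.Nat as ℕ using (ℕ; zero; suc; _∸_; _^_; _≤_; _<_; _<?_; s≤s; z<s)
open import Data.Nat.Induction using (<-rec)
open import Data.Nat.Properties
  using (<-cmp; <-trans; <-≤-trans; <⇒≤; <⇒≱; ≤-refl; ≮⇒≥; m≤n+m; n<1+n; suc-injective)
open import Data.Product using (∃; _×_; _,_; proj₁; proj₂; uncurry)
open import Data.Product.Function.NonDependent.Propositional using (_×-↔_)
open import Data.Sum using (_⊎_; inj₁; inj₂)
open import Data.Vec as Vec using (Vec; []; _∷_; _∷ʳ_; initLast; last; tabulate; toList)
open import Data.Vec.Properties using (∷-injectiveˡ; ∷-injectiveʳ; toList-map)
open import Function.Base using (_∘_)
open import Function.Bundles using (_↔_; mk↔ₛ′; Injection; Inverse)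
open import Function.Definitions using (Injective)
open import Function.Properties.Inverse using (↔-sym; ↔-trans; ↔⇒↣)
open import Relation.Binary.Definitions using (tri<; tri≈; tri>)
open import Relation.Binary.PropositionalEquality
  using (_≡_; _≢_; refl; sym; trans; cong; cong₂; subst; subst₂; module ≡-Reasoning)
open import Relation.Binary.Structures using (IsEquivalence)
open import Relation.Nullary using (¬_; yes; no; contradiction)
open import Relation.Unary using (Pred)
open import Defs

open xor-∧-Solver using (solve; _:=_; _:+_; _:*_; con)

private
  variable
    a ℓ : Level
    A : Set a
    k : ℕ

-- Polynomials over ℤ₂ as a commutative semiring

coeff-+ₚ : ∀ f g i → coeff (f +ₚ g) i ≡ coeff f i xor coeff g i
coeff-+ₚ []      g       i       = refl
coeff-+ₚ (a ∷ f) []      i       = sym (xor-identityʳ (coeff (a ∷ f) i))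
coeff-+ₚ (a ∷ f) (b ∷ g) zero    = refl
coeff-+ₚ (a ∷ f) (b ∷ g) (suc i) = coeff-+ₚ f g i

coeff-map-∧ : ∀ a f i → coeff (map (a ∧_) f) i ≡ a ∧ coeff f i
coeff-map-∧ a []      i       = sym (∧-zeroʳ a)
coeff-map-∧ a (b ∷ f) zero    = refl
coeff-map-∧ a (b ∷ f) (suc i) = coeff-map-∧ a f i

coeff-∷*ₚ : ∀ a f g i →
  coeff ((a ∷ f) *ₚ g) i ≡ (a ∧ coeff g i) xor coeff (false ∷ f *ₚ g) i
coeff-∷*ₚ a f g i = trans
  (coeff-+ₚ (map (a ∧_) g) (false ∷ f *ₚ g) i)
  (cong (_xor coeff (false ∷ f *ₚ g) i) (coeff-map-∧ a g i))

shift-cong : ∀ f g → f ≈ₚ g → (false ∷ f) ≈ₚ (false ∷ g)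
shift-cong f g f≈g zero    = refl
shift-cong f g f≈g (suc i) = f≈g i

+ₚ-cong : ∀ {f f′ g g′} → f ≈ₚ f′ → g ≈ₚ g′ → (f +ₚ g) ≈ₚ (f′ +ₚ g′)
+ₚ-cong {f} {f′} {g} {g′} f≈f′ g≈g′ i
  rewrite coeff-+ₚ f g i | coeff-+ₚ f′ g′ i = cong₂ _xor_ (f≈f′ i) (g≈g′ i)

+ₚ-assoc : ∀ f g h → ((f +ₚ g) +ₚ h) ≈ₚ (f +ₚ (g +ₚ h))
+ₚ-assoc f g h i
  rewrite coeff-+ₚ (f +ₚ g) h i | coeff-+ₚ f g i
        | coeff-+ₚ f (g +ₚ h) i | coeff-+ₚ g h i
  = xor-assoc (coeff f i) (coeff g i) (coeff h i)

+ₚ-comm : ∀ f g → (f +ₚ g) ≈ₚ (g +ₚ f)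
+ₚ-comm f g i rewrite coeff-+ₚ f g i | coeff-+ₚ g f i =
  xor-comm (coeff f i) (coeff g i)

+ₚ-self : ∀ f → (f +ₚ f) ≈ₚ []
+ₚ-self f i = trans (coeff-+ₚ f f i) (xor-same (coeff f i))

*ₚ-congʳ : ∀ f {g g′} → g ≈ₚ g′ → (f *ₚ g) ≈ₚ (f *ₚ g′)
*ₚ-congʳ []      g≈g′ i = refl
*ₚ-congʳ (a ∷ f) {g} {g′} g≈g′ i
  rewrite coeff-∷*ₚ a f g i | coeff-∷*ₚ a f g′ i =
  cong₂ (λ b c → (a ∧ b) xor c) (g≈g′ i) (shift-cong (f *ₚ g) (f *ₚ g′) (*ₚ-congʳ f g≈g′) i)

*ₚ-zeroʳ : ∀ f → (f *ₚ []) ≈ₚ []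
*ₚ-zeroʳ []      i       = refl
*ₚ-zeroʳ (a ∷ f) zero    = refl
*ₚ-zeroʳ (a ∷ f) (suc i) = *ₚ-zeroʳ f i

-- `_*ₚ_` recurses on its left factor. This is the mirror recursion on the right factor, from which
-- commutativity follows by induction.
*ₚ-∷ : ∀ f b g → (f *ₚ (b ∷ g)) ≈ₚ (map (b ∧_) f +ₚ (false ∷ f *ₚ g))
*ₚ-∷ []      b g zero    = refl
*ₚ-∷ []      b g (suc i) = refl
*ₚ-∷ (a ∷ f) b g zero    =
  solve 2 (λ a b → a :* b :+ con false := b :* a :+ con false) refl a b
*ₚ-∷ (a ∷ f) b g (suc i)
  rewrite coeff-+ₚ (map (a ∧_) g) (f *ₚ (b ∷ g)) i
        | coeff-map-∧ a g i
        | *ₚ-∷ f b g i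
        | coeff-+ₚ (map (b ∧_) f) (false ∷ f *ₚ g) i
        | coeff-+ₚ (map (b ∧_) f) (map (a ∧_) g +ₚ (false ∷ f *ₚ g)) i
        | coeff-+ₚ (map (a ∧_) g) (false ∷ f *ₚ g) i
        | coeff-map-∧ a g i =
  solve 3 (λ x y z → x :+ (y :+ z) := y :+ (x :+ z)) refl
    (a ∧ coeff g i) (coeff (map (b ∧_) f) i) (coeff (false ∷ f *ₚ g) i)

*ₚ-comm : ∀ f g → (f *ₚ g) ≈ₚ (g *ₚ f)
*ₚ-comm f []      i = *ₚ-zeroʳ f i
*ₚ-comm f (b ∷ g) i = begin
  coeff (f *ₚ (b ∷ g)) i                           ≡⟨ *ₚ-∷ f b g i ⟩
  coeff (map (b ∧_) f +ₚ (false ∷ f *ₚ g)) i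
    ≡⟨ coeff-+ₚ (map (b ∧_) f) (false ∷ f *ₚ g) i ⟩
  coeff (map (b ∧_) f) i xor coeff (false ∷ f *ₚ g) i
    ≡⟨ cong (coeff (map (b ∧_) f) i xor_)
         (shift-cong (f *ₚ g) (g *ₚ f) (*ₚ-comm f g) i) ⟩
  coeff (map (b ∧_) f) i xor coeff (false ∷ g *ₚ f) i
    ≡⟨ coeff-+ₚ (map (b ∧_) f) (false ∷ g *ₚ f) i ⟨
  coeff ((b ∷ g) *ₚ f) i                           ∎
  where open ≡-Reasoning

-- Equal left factors may be lists of different lengths, which complicates an induction on them;
-- commutativity brings them to the right, where `*ₚ-congʳ` applies.
*ₚ-cong : ∀ {f f′ g g′} → f ≈ₚ f′ → g ≈ₚ g′ → (f *ₚ g) ≈ₚ (f′ *ₚ g′)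
*ₚ-cong {f} {f′} {g} {g′} f≈f′ g≈g′ i = begin
  coeff (f *ₚ g) i    ≡⟨ *ₚ-congʳ f g≈g′ i ⟩
  coeff (f *ₚ g′) i   ≡⟨ *ₚ-comm f g′ i ⟩
  coeff (g′ *ₚ f) i   ≡⟨ *ₚ-congʳ g′ f≈f′ i ⟩
  coeff (g′ *ₚ f′) i  ≡⟨ *ₚ-comm g′ f′ i ⟩
  coeff (f′ *ₚ g′) i  ∎
  where open ≡-Reasoning

*ₚ-distribʳ-+ₚ : ∀ h f g → ((f +ₚ g) *ₚ h) ≈ₚ (f *ₚ h +ₚ g *ₚ h)
*ₚ-distribʳ-+ₚ h []      g       i = refl
*ₚ-distribʳ-+ₚ h (a ∷ f) []      i =
  sym (trans (coeff-+ₚ ((a ∷ f) *ₚ h) [] i) (xor-identityʳ _))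
*ₚ-distribʳ-+ₚ h (a ∷ f) (b ∷ g) i
  rewrite coeff-+ₚ ((a ∷ f) *ₚ h) ((b ∷ g) *ₚ h) i
        | coeff-∷*ₚ (a xor b) (f +ₚ g) h i
        | coeff-∷*ₚ a f h i | coeff-∷*ₚ b g h i
        | shift-cong ((f +ₚ g) *ₚ h) (f *ₚ h +ₚ g *ₚ h) (*ₚ-distribʳ-+ₚ h f g) i
        | coeff-+ₚ (false ∷ f *ₚ h) (false ∷ g *ₚ h) i =
  solve 5 (λ a b c x y → (a :+ b) :* c :+ (x :+ y) := (a :* c :+ x) :+ (b :* c :+ y)) refl
    a b (coeff h i) (coeff (false ∷ f *ₚ h) i) (coeff (false ∷ g *ₚ h) i)

coeff-∷-map-∧ : ∀ a f i → coeff (false ∷ map (a ∧_) f) i ≡ a ∧ coeff (false ∷ f) i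
coeff-∷-map-∧ a f zero    = sym (∧-zeroʳ a)
coeff-∷-map-∧ a f (suc i) = coeff-map-∧ a f i

map-∧-*ₚ : ∀ a f g → (map (a ∧_) f *ₚ g) ≈ₚ map (a ∧_) (f *ₚ g)
map-∧-*ₚ a []      g i = refl
map-∧-*ₚ a (b ∷ f) g i
  rewrite coeff-∷*ₚ (a ∧ b) (map (a ∧_) f) g i
        | coeff-map-∧ a ((b ∷ f) *ₚ g) i
        | coeff-∷*ₚ b f g i
        | shift-cong (map (a ∧_) f *ₚ g) (map (a ∧_) (f *ₚ g)) (map-∧-*ₚ a f g) i
        | coeff-∷-map-∧ a (f *ₚ g) i =
  solve 4 (λ a b c x → a :* b :* c :+ a :* x := a :* (b :* c :+ x)) refl
    a b (coeff g i) (coeff (false ∷ f *ₚ g) i)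

-- Peeling the constant term off `f` leaves a scalar multiple and a shift, and both are compatible
-- with multiplication by `h`.
*ₚ-assoc : ∀ f g h → ((f *ₚ g) *ₚ h) ≈ₚ (f *ₚ (g *ₚ h))
*ₚ-assoc []      g h i = refl
*ₚ-assoc (a ∷ f) g h i
  rewrite *ₚ-distribʳ-+ₚ h (map (a ∧_) g) (false ∷ f *ₚ g) i
        | coeff-+ₚ (map (a ∧_) g *ₚ h) ((false ∷ f *ₚ g) *ₚ h) i
        | map-∧-*ₚ a g h i
        | coeff-∷*ₚ false (f *ₚ g) h i
        | shift-cong ((f *ₚ g) *ₚ h) (f *ₚ (g *ₚ h)) (*ₚ-assoc f g h) i
  = sym (coeff-+ₚ (map (a ∧_) (g *ₚ h)) (false ∷ f *ₚ (g *ₚ h)) i)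

*ₚ-identityˡ : ∀ f → ((true ∷ []) *ₚ f) ≈ₚ f
*ₚ-identityˡ f i = trans (coeff-∷*ₚ true [] f i) (unshift f i)
  where
  unshift : ∀ f i → coeff f i xor coeff (false ∷ []) i ≡ coeff f i
  unshift f zero    = xor-identityʳ (coeff f zero)
  unshift f (suc i) = xor-identityʳ (coeff f (suc i))

polyCommutativeSemiring : CommutativeSemiring 0ℓ 0ℓ
polyCommutativeSemiring = record
  { RawSemiring polyRawSemiring
  ; isCommutativeSemiring = isCommutativeSemiringˡ (record
    { +-isCommutativeMonoid = record
      { isMonoid = record
        { isSemigroup = record
          { isMagma = record
            { isEquivalence = ≈ₚ-isEquivalence
            ; ∙-cong = λ {f} {f′} {g} {g′} → +ₚ-cong {f} {f′} {g} {g′} }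
          ; assoc = +ₚ-assoc }
        ; identity = (λ f i → refl) , λ f i → trans (coeff-+ₚ f [] i) (xor-identityʳ _) }
      ; comm = +ₚ-comm }
    ; *-isCommutativeMonoid = record
      { isMonoid = record
        { isSemigroup = record
          { isMagma = record
            { isEquivalence = ≈ₚ-isEquivalence
            ; ∙-cong = λ {f} {f′} {g} {g′} → *ₚ-cong {f} {f′} {g} {g′} }
          ; assoc = *ₚ-assoc }
        ; identity = *ₚ-identityˡ
                   , λ f i → trans (*ₚ-comm f (true ∷ []) i) (*ₚ-identityˡ f i) }
      ; comm = *ₚ-comm }
    ; distribʳ = *ₚ-distribʳ-+ₚ
    ; zeroˡ = λ f i → refl
    })
  }
  where
  ≈ₚ-isEquivalence : IsEquivalence _≈ₚ_
  ≈ₚ-isEquivalence = record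
    { refl  = λ i → refl
    ; sym   = λ f≈g i → sym (f≈g i)
    ; trans = λ f≈g g≈h i → trans (f≈g i) (g≈h i)
    }

-- Congruence modulo an element in characteristic two

CharacteristicTwo : ∀ {c ℓ} → CommutativeSemiring c ℓ → Set _
CharacteristicTwo R = ∀ x → x + x ≈ 0#
  where open CommutativeSemiring R

module CharacteristicTwoDivisibility {c ℓ} (R : CommutativeSemiring c ℓ)
  (x+x≈0 : CharacteristicTwo R) where

  open CommutativeSemiring R renaming (sym to ≈-sym; trans to ≈-trans) hiding (refl)
  open import Algebra.Properties.Semiring.Divisibility semiring
    using (_∣_; _,_; ∣ʳ-respʳ-≈; x∣ʳy⇒x∣ʳzy; x∣ʳyx)
  open import Algebra.Properties.CommutativeSemigroup +-commutativeSemigroup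
    using (interchange)
  open import Relation.Binary.Reasoning.Setoid setoid

  x+[x+y]≈y : ∀ x y → x + (x + y) ≈ y
  x+[x+y]≈y x y = begin
    x + (x + y)  ≈⟨ +-assoc x x y ⟨
    (x + x) + y  ≈⟨ +-congʳ (x+x≈0 x) ⟩
    0# + y       ≈⟨ +-identityˡ y ⟩
    y            ∎

  ∣-+ : ∀ {p x y} → p ∣ x → p ∣ y → p ∣ x + y
  ∣-+ (a , ap≈x) (b , bp≈y) = a + b , ≈-trans (distribʳ _ a b) (+-cong ap≈x bp≈y)

  -- In characteristic two, `p ∣ x + z` says that `x` and `z` are congruent modulo `p`. This is
  -- transitivity through `y`, whose two copies cancel.
  ∣-cancel : ∀ {p x y z} → p ∣ y + x → p ∣ y + z → p ∣ x + z
  ∣-cancel {p} {x} {y} {z} p∣y+x p∣y+z = ∣ʳ-respʳ-≈ (begin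
    (y + x) + (y + z)  ≈⟨ +-congʳ (+-comm y x) ⟩
    (x + y) + (y + z)  ≈⟨ +-assoc x y (y + z) ⟩
    x + (y + (y + z))  ≈⟨ +-congˡ (x+[x+y]≈y y z) ⟩
    x + z              ∎) (∣-+ p∣y+x p∣y+z)

  ∣-remainder : ∀ {q x} s {r} → x ≈ s * q + r → q ∣ x + r
  ∣-remainder {q} {x} s {r} x≈sq+r = s , (begin
    s * q            ≈⟨ x+[x+y]≈y r (s * q) ⟨
    r + (r + s * q)  ≈⟨ +-congˡ (+-comm r (s * q)) ⟩
    r + (s * q + r)  ≈⟨ +-congˡ x≈sq+r ⟨
    r + x            ≈⟨ +-comm r x ⟩
    x + r            ∎)

  -- In characteristic two `r` equals `s * x + q`, so `r * y` is a multiple of `x * y` plus a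
  -- multiple of `q`. This hands the hypothesis of `euclid` on to the remainder.
  ∣x*y⇒∣r*y : ∀ {q x y} s {r} → q ≈ s * x + r → q ∣ x * y → q ∣ r * y
  ∣x*y⇒∣r*y {q} {x} {y} s {r} q≈sx+r q∣xy = ∣ʳ-respʳ-≈ (begin
    s * (x * y) + y * q            ≈⟨ +-cong (≈-sym (*-assoc s x y)) (*-comm y q) ⟩
    s * x * y + q * y              ≈⟨ distribʳ y (s * x) q ⟨
    (s * x + q) * y                ≈⟨ *-congʳ (+-congˡ q≈sx+r) ⟩
    (s * x + (s * x + r)) * y      ≈⟨ *-congʳ (x+[x+y]≈y (s * x) r) ⟩
    r * y                          ∎)
    (∣-+ (x∣ʳy⇒x∣ʳzy s q∣xy) (x∣ʳyx q y))

  unit-cancel-∣ : ∀ {q x y} → x ∣ 1# → q ∣ x * y → q ∣ y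
  unit-cancel-∣ {q} {x} {y} (t , tx≈1) q∣xy = ∣ʳ-respʳ-≈ (begin
    t * (x * y)  ≈⟨ *-assoc t x y ⟨
    t * x * y    ≈⟨ *-congʳ tx≈1 ⟩
    1# * y       ≈⟨ *-identityˡ y ⟩
    y            ∎) (x∣ʳy⇒x∣ʳzy t q∣xy)

  -- The congruences of `x * y` with `z` and of `x * y′` with `z′` add up. With field products for
  -- `z` and `z′` this becomes distributivity in the field.
  ∣-+-distrib : ∀ {p y y′ z z′} x →
    p ∣ x * y + z → p ∣ x * y′ + z′ → p ∣ x * (y + y′) + (z + z′)
  ∣-+-distrib {p} {y} {y′} {z} {z′} x p∣xy+z p∣xy′+z′ = ∣ʳ-respʳ-≈ (begin
    (x * y + z) + (x * y′ + z′)  ≈⟨ interchange (x * y) z (x * y′) z′ ⟩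
    (x * y + x * y′) + (z + z′)  ≈⟨ +-congʳ (distribˡ x y y′) ⟨
    x * (y + y′) + (z + z′)      ∎) (∣-+ p∣xy+z p∣xy′+z′)

open CharacteristicTwoDivisibility polyCommutativeSemiring +ₚ-self
open SemiringDefs polyRawSemiring using (_∣_)
open SemiringDivisibility (CommutativeSemiring.semiring polyCommutativeSemiring)
  using (_,_; ∣ʳ-respʳ-≈; ∣ʳ-reflexive)

-- Degree of a polynomial

-- Trailing zeros are allowed, so the tail is inspected first: the constant term is leading only
-- when the tail vanishes.
degree? : ∀ f → f ≈ₚ [] ⊎ ∃ (HasDegree f)
degree? []      = inj₁ λ i → refl
degree? (a ∷ f) with degree? f
... | inj₂ (d , f_d , high) = inj₂ (suc d , f_d , λ { (suc j) (s≤s d<j) → high j d<j })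
degree? (true  ∷ f) | inj₁ f≈0 = inj₂ (0 , refl , λ { (suc j) _ → f≈0 j })
degree? (false ∷ f) | inj₁ f≈0 = inj₁ λ { zero → refl ; (suc i) → f≈0 i }

HasDegree⇒≉0 : ∀ {f d} → HasDegree f d → ¬ f ≈ₚ []
HasDegree⇒≉0 (f_d , _) f≈0 with () ← trans (sym f_d) (f≈0 _)

-- Follow `t` to its leading coefficient. Each head passed on the way meets a coefficient of `q`
-- above its degree, hence zero; at the end the tail of `t` vanishes and the coefficient is that of
-- `q` itself.
coeff-leading : ∀ t q {d e} → HasDegree t d → HasDegree q e →
  coeff (t *ₚ q) (d ℕ.+ e) ≡ true
coeff-leading []          q (() , _)
coeff-leading (true ∷ t)  q {zero} {e} (refl , t-high) (q_e , _)
  rewrite coeff-∷*ₚ true t q e | q_e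
        | shift-cong (t *ₚ q) [] (*ₚ-cong {t} {[]} {q} {q} (λ i → t-high (suc i) z<s) (λ _ → refl)) e
  = lemma e
  where
  lemma : ∀ e → true xor coeff (false ∷ []) e ≡ true
  lemma zero    = refl
  lemma (suc e) = refl
coeff-leading (a ∷ t)     q {suc d} {e} (t_d , t-high) hq@(q_e , q-high)
  rewrite coeff-∷*ₚ a t q (suc (d ℕ.+ e))
        | q-high (suc (d ℕ.+ e)) (s≤s (m≤n+m e d)) | ∧-zeroʳ a
  = coeff-leading t q (t_d , λ j d<j → t-high (suc j) (s≤s d<j)) hq

-- By `coeff-leading`, a nonzero quotient of degree `d` would put a coefficient 1 in degree `d + k`.
-- Hence a class modulo `q` has only one representative of degree less than `k`.
∣∧small⇒≈0 : ∀ {q f k} → HasDegree q k → q ∣ f → (∀ j → k ≤ j → coeff f j ≡ false) → f ≈ₚ []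
∣∧small⇒≈0 {q} {f} {k} hq (t , tq≈f) small with degree? t
... | inj₁ t≈0 = λ i →
  trans (sym (tq≈f i)) (*ₚ-cong {t} {[]} {q} {q} t≈0 (λ _ → refl) i)
... | inj₂ (d , ht) with () ←
  trans (sym (coeff-leading t q ht hq)) (trans (tq≈f (d ℕ.+ k)) (small (d ℕ.+ k) (m≤n+m k d)))

-- Coordinate vectors as polynomials of degree less than k

coeff-toList-≥ : ∀ {k} (v : Vec Bool k) i → k ≤ i → coeff (toList v) i ≡ false
coeff-toList-≥ []       i       _         = refl
coeff-toList-≥ (a ∷ v) (suc i) (s≤s k≤i) = coeff-toList-≥ v i k≤i

coeff-tabulate : ∀ {k} (g : ℕ → Bool) {i} → i < k →
  coeff (toList (tabulate {n = k} (g ∘ toℕ))) i ≡ g i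
coeff-tabulate {suc k} g {zero}  _         = refl
coeff-tabulate {suc k} g {suc i} (s≤s i<k) = coeff-tabulate (g ∘ suc) i<k

coeff-∷ʳ-< : ∀ {k} (v : Vec Bool k) a {i} → i < k →
  coeff (toList (v ∷ʳ a)) i ≡ coeff (toList v) i
coeff-∷ʳ-< (b ∷ v) a {zero}  _         = refl
coeff-∷ʳ-< (b ∷ v) a {suc i} (s≤s i<k) = coeff-∷ʳ-< v a i<k

coeff-∷ʳ-last : ∀ {k} (v : Vec Bool k) a → coeff (toList (v ∷ʳ a)) k ≡ a
coeff-∷ʳ-last []      a = refl
coeff-∷ʳ-last (b ∷ v) a = coeff-∷ʳ-last v a

toList--F : ∀ {k} (x y : GF k) → toList (x -F y) ≡ toList x +ₚ toList y
toList--F []      []      = refl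
toList--F (a ∷ x) (b ∷ y) = cong (_ ∷_) (toList--F x y)

toList-0F : ∀ {k} → toList (0F {k}) ≈ₚ []
toList-0F {zero}  i       = refl
toList-0F {suc k} zero    = refl
toList-0F {suc k} (suc i) = toList-0F {k} i

coeff-toList-injective : ∀ {k} (x y : GF k) → toList x ≈ₚ toList y → x ≡ y
coeff-toList-injective []      []      _   = refl
coeff-toList-injective (a ∷ x) (b ∷ y) x≈y =
  cong₂ _∷_ (x≈y 0) (coeff-toList-injective x y (x≈y ∘ suc))

toList≈0⇒≡0F : ∀ {k} (x : GF k) → toList x ≈ₚ [] → x ≡ 0F
toList≈0⇒≡0F {k} x x≈0 =
  coeff-toList-injective x 0F λ i → trans (x≈0 i) (sym (toList-0F {k} i))

degree< : ∀ {k} (x : Vec Bool k) {d} → HasDegree (toList x) d → d < k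
degree< {k} x {d} (x_d , _) with d <? k
... | yes d<k = d<k
... | no d≮k with () ← trans (sym x_d) (coeff-toList-≥ x d (≮⇒≥ d≮k))

≢0F⇒HasDegree : ∀ {k} (x : GF k) → x ≢ 0F → ∃ (HasDegree (toList x))
≢0F⇒HasDegree x x≢0 with degree? (toList x)
... | inj₁ x≈0 = contradiction (toList≈0⇒≡0F x x≈0) x≢0
... | inj₂ hx  = hx

x-Fx≡0F : ∀ {k} (x : GF k) → x -F x ≡ 0F
x-Fx≡0F []      = refl
x-Fx≡0F (a ∷ x) = cong₂ _∷_ (xor-same a) (x-Fx≡0F x)

x-Fy≡0F⇒x≡y : ∀ {k} (x y : GF k) → x -F y ≡ 0F → x ≡ y
x-Fy≡0F⇒x≡y []      []      _ = refl
x-Fy≡0F⇒x≡y (a ∷ x) (b ∷ y) eq =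
  cong₂ _∷_ (xor≡false a b (∷-injectiveˡ eq)) (x-Fy≡0F⇒x≡y x y (∷-injectiveʳ eq))
  where
  xor≡false : ∀ a b → a xor b ≡ false → a ≡ b
  xor≡false false b     eq   = sym eq
  xor≡false true  true  refl = refl

-- Division with remainder and Euclid's lemma

reduce-spec : ∀ {q k} → HasDegree q k → (v : Vec Bool (suc k)) →
  toList (reduce q v) ≈ₚ (toList v +ₚ map (last v ∧_) q)
reduce-spec {q} {k} (q_k , high) v i
  with ys , y , refl ← initLast v
  rewrite toList--F ys (Vec.map (y ∧_) (tabulate (coeff q ∘ toℕ)))
        | toList-map (y ∧_) (tabulate {n = k} (coeff q ∘ toℕ))
        | coeff-+ₚ (toList ys) (map (y ∧_) (toList (tabulate {n = k} (coeff q ∘ toℕ)))) i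
        | coeff-map-∧ y (toList (tabulate {n = k} (coeff q ∘ toℕ))) i
        | coeff-+ₚ (toList (ys ∷ʳ y)) (map (y ∧_) q) i
        | coeff-map-∧ y q i
  with <-cmp i k
... | tri< i<k _ _ rewrite coeff-∷ʳ-< ys y i<k | coeff-tabulate (coeff q) i<k = refl
-- The index at which `init` cuts off the coefficient `y` of X^k: on the right, `y` cancels against
-- `y` times the leading coefficient of `q`.
... | tri≈ _ refl _ rewrite coeff-∷ʳ-last ys y | q_k
        | coeff-toList-≥ ys k ≤-refl
        | coeff-toList-≥ (tabulate {n = k} (coeff q ∘ toℕ)) k ≤-refl
        = solve 1 (λ y → y :* con false := y :+ y :* con true) refl y
... | tri> _ _ k<i rewrite coeff-toList-≥ (ys ∷ʳ y) i k<i | high i k<i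
        | coeff-toList-≥ ys i (<⇒≤ k<i)
        | coeff-toList-≥ (tabulate {n = k} (coeff q ∘ toℕ)) i (<⇒≤ k<i) = refl

-- Horner's scheme, following the recursion of `class`. It is stated for any divisor of known degree
-- because `euclid` also divides `q` itself by polynomials of smaller degree.
class-spec : ∀ {q k} → HasDegree q k → ∀ f → ∃ λ s → f ≈ₚ (s *ₚ q +ₚ toList (class {k} q f))
class-spec {k = k} hq []      = [] , λ i → sym (toList-0F {k} i)
class-spec {q} {k} hq (a ∷ f) with class-spec {q} {k} hq f
... | s , f≈sq+r = b ∷ s , eq
  where
  r = class {k} q f
  -- The coefficient of X^k in a + X r. `reduce` subtracts `q` times it, so it is the constant term
  -- of the new quotient.
  b = last (a ∷ r)
  shift : ∀ i → coeff (a ∷ f) i ≡ coeff (false ∷ s *ₚ q) i xor coeff (a ∷ toList r) i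
  shift zero    = refl
  shift (suc i) = trans (f≈sq+r i) (coeff-+ₚ (s *ₚ q) (toList r) i)
  eq : (a ∷ f) ≈ₚ ((b ∷ s) *ₚ q +ₚ toList (reduce q (a ∷ r)))
  eq i rewrite coeff-+ₚ ((b ∷ s) *ₚ q) (toList (reduce q (a ∷ r))) i
             | coeff-∷*ₚ b s q i
             | reduce-spec {q} hq (a ∷ r) i
             | coeff-+ₚ (a ∷ toList r) (map (b ∧_) q) i
             | coeff-map-∧ b q i
             | shift i
    = solve 3 (λ x y z → x :+ y := (z :+ x) :+ (y :+ z)) refl
        (coeff (false ∷ s *ₚ q) i) (coeff (a ∷ toList r) i) (b ∧ coeff q i)

-- The remainder r of q modulo x also satisfies q ∣ r y, so by descent on
-- the degree of x we may assume that x divides q.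
euclid : ∀ {q k y} → HasDegree q k → Irreducible q →
  ∀ {d x} → d < k → HasDegree x d → q ∣ x *ₚ y → q ∣ y
euclid {q} {k} {y} hq irr {d} {x} = <-rec P step d x
  where
  P : ℕ → Set
  P d = ∀ x → d < k → HasDegree x d → q ∣ x *ₚ y → q ∣ y

  exact : ∀ {d} s x → d < k → HasDegree x d → q ≈ₚ (s *ₚ x) → q ∣ x *ₚ y → q ∣ y
  exact s x d<k hx q≈sx q∣xy with Irreducible.split-∣1 irr {s} {x} q≈sx
  ... | inj₂ x∣1 = unit-cancel-∣ x∣1 q∣xy
  -- A unit `s` would make `q` divide `x`, which is nonzero of degree less than `k`.
  ... | inj₁ s∣1 = contradiction
    (∣∧small⇒≈0 hq (unit-cancel-∣ s∣1 (∣ʳ-reflexive {q} {s *ₚ x} q≈sx))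
      λ j k≤j → proj₂ hx j (<-≤-trans d<k k≤j))
    (HasDegree⇒≉0 {x} hx)

  step : ∀ d → (∀ {e} → e < d → P e) → P d
  step d rec x d<k hx q∣xy with class-spec {x} {d} hx q
  ... | s , q≈sx+r with degree? (toList (class {d} x q))
  ...   | inj₁ r≈0 = exact s x d<k hx
    (λ i → trans (q≈sx+r i) (trans (coeff-+ₚ (s *ₚ x) (toList (class {d} x q)) i)
      (trans (cong (coeff (s *ₚ x) i xor_) (r≈0 i)) (xor-identityʳ _)))) q∣xy
  ...   | inj₂ (e , hr) = rec e<d (toList (class {d} x q)) (<-trans e<d d<k) hr
      (∣x*y⇒∣r*y {q} {x} {y} s {toList (class {d} x q)} q≈sx+r q∣xy)
    where
    -- The remainder modulo `x` has only `d` coordinates. For `d` equal to zero it is empty, so the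
    -- descent ends in `exact`.
    e<d : e < d
    e<d = degree< (class {d} x q) hr

-- Finite sets: pigeonhole principle and enumerations

-- Pigeonhole principle: if `y` were missed, deleting its index would turn `f` into an injection
-- from `Fin (suc n)` into `Fin n`. Going through `e` also makes the search for a preimage
-- decidable.
injective⇒surjective : ∀ {n} {A : Set a} → Fin n ↔ A →
  ∀ {f : A → A} → Injective _≡_ _≡_ f → ∀ y → ∃ λ x → f x ≡ y
injective⇒surjective {n = zero}  e f-inj y with () ← Inverse.from e y
injective⇒surjective {n = suc n} e {f} f-inj y
  with any? (λ i → Inverse.from e (f (Inverse.to e i)) ≟ Inverse.from e y)
... | yes (i , eq) = Inverse.to e i , Injection.injective (↔⇒↣ (↔-sym e)) eq
... | no  y∉f = contradiction (injective⇒≤ {f = g} g-inj) (<⇒≱ (n<1+n n))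
  where
  g : Fin (suc n) → Fin n
  g i = punchOut {i = Inverse.from e y} (λ eq → y∉f (i , sym eq))
  g-inj : Injective _≡_ _≡_ g
  g-inj eq = Injection.injective (↔⇒↣ e)
    (f-inj (Injection.injective (↔⇒↣ (↔-sym e))
      (punchOut-injective (y∉f ∘ (_ ,_) ∘ sym) (y∉f ∘ (_ ,_) ∘ sym) eq)))

bits↔ : ∀ k → Fin (2 ^ k) ↔ Vec Bool k
bits↔ zero    = mk↔ₛ′ (λ _ → []) (λ _ → zero) (λ { [] → refl }) (λ { zero → refl })
bits↔ (suc k) = ↔-trans *↔× (↔-trans (2↔Bool ×-↔ bits↔ k)
  (mk↔ₛ′ (uncurry _∷_) (λ { (b ∷ v) → b , v }) (λ { (b ∷ v) → refl }) (λ _ → refl)))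

-- Indices are matched with elements rather than with pairs of an element and a proof, since proofs
-- of `P x` may differ for the same `x`.
record Enumeration {A : Set} (P : A → Set) (n : ℕ) : Set where
  field
    elem      : Fin n → A
    sound     : ∀ i → P (elem i)
    injective : Injective _≡_ _≡_ elem
    complete  : ∀ x → P x → ∃ λ i → elem i ≡ x

enumerate-≢ : ∀ {n} {A : Set} → Fin n ↔ A → (x : A) → Enumeration (_≢ x) (n ∸ 1)
enumerate-≢ {n = zero}  e x with () ← Inverse.from e x
enumerate-≢ {n = suc n} e x = record
  { elem      = to ∘ punchIn i
  ; sound     = λ j eq → punchInᵢ≢i i j (sym (inverseʳ (sym eq)))
  ; injective = λ eq → punchIn-injective i _ _ (Injection.injective (↔⇒↣ e) eq)
  ; complete  = λ y y≢x →
      let i≢j = λ i≡j → y≢x (Injection.injective (↔⇒↣ (↔-sym e)) (sym i≡j))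
      in punchOut i≢j , inverseˡ (punchIn-punchOut i≢j)
  }
  where
  open Inverse e
  i = from x

withDegree : ∀ {k d} → d < k → Vec Bool d → GF k
withDegree {suc k} {zero}  d<k       v       = true ∷ 0F
withDegree {suc k} {suc d} (s≤s d<k) (a ∷ v) = a ∷ withDegree d<k v

withDegree-HasDegree : ∀ {k d} (d<k : d < k) v → HasDegree (toList (withDegree d<k v)) d
withDegree-HasDegree {suc k} {zero}  d<k       v       = refl , λ { (suc j) _ → toList-0F {k} j }
withDegree-HasDegree {suc k} {suc d} (s≤s d<k) (a ∷ v) with withDegree-HasDegree d<k v
... | v_d , high = v_d , λ { (suc j) (s≤s d<j) → high j d<j }

withDegree-injective : ∀ {k d} (d<k : d < k) → Injective _≡_ _≡_ (withDegree d<k)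
withDegree-injective {suc k} {zero}  d<k       {[]}    {[]}    eq = refl
withDegree-injective {suc k} {suc d} (s≤s d<k) {a ∷ v} {b ∷ w} eq =
  cong₂ _∷_ (∷-injectiveˡ eq) (withDegree-injective d<k (∷-injectiveʳ eq))

withDegree-surjective : ∀ {k d} (d<k : d < k) (x : GF k) → HasDegree (toList x) d →
  ∃ λ v → withDegree d<k v ≡ x
withDegree-surjective {suc k} {zero}  d<k       (.true ∷ x) (refl , high) =
  [] , cong (true ∷_) (sym (toList≈0⇒≡0F x λ i → high (suc i) z<s))
withDegree-surjective {suc k} {suc d} (s≤s d<k) (a ∷ x)     (x_d , high) =
  let v , eq = withDegree-surjective d<k x (x_d , λ j d<j → high (suc j) (s≤s d<j))
  in a ∷ v , cong (a ∷_) eq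

-- The leading 1 sits in position `d` with zeros above it; the `d` coordinates below are free,
-- whence the power of two.
enumerate-HasDegree : ∀ {k d} → d < k →
  Enumeration (λ (x : GF k) → HasDegree (toList x) d) (2 ^ d)
enumerate-HasDegree {d = d} d<k = record
  { elem      = withDegree d<k ∘ to
  ; sound     = λ i → withDegree-HasDegree d<k (to i)
  ; injective = Injection.injective (↔⇒↣ (bits↔ d)) ∘ withDegree-injective d<k
  ; complete  = λ x hx →
      let v , eq = withDegree-surjective d<k x hx
      in from v , trans (cong (withDegree d<k) (strictlyInverseˡ v)) eq
  }
  where open Inverse (bits↔ d)

-- Arithmetic of GF(2^k)

module GaloisField {k q} (hq : HasDegree q k) (irr : Irreducible q) where

  infixl 7 _·_
  _·_ : GF k → GF k → GF k
  _·_ = mulF q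

  ·-spec : ∀ x y → q ∣ toList x *ₚ toList y +ₚ toList (x · y)
  ·-spec x y with class-spec hq (toList x *ₚ toList y)
  ... | s , xy≈sq+r = ∣-remainder {q} {toList x *ₚ toList y} s {toList (x · y)} xy≈sq+r

  ∣x+y⇒x≡y : ∀ (x y : GF k) → q ∣ toList x +ₚ toList y → x ≡ y
  ∣x+y⇒x≡y x y q∣x+y = x-Fy≡0F⇒x≡y x y (toList≈0⇒≡0F (x -F y)
    (∣∧small⇒≈0 hq (subst (q ∣_) (sym (toList--F x y)) q∣x+y) (coeff-toList-≥ (x -F y))))

  -- `z` and `x · y` are both congruent to the polynomial product and both of degree less than `k`,
  -- so they coincide. Commutativity and distributivity in the field thus become congruences of
  -- polynomials.
  ·-unique : ∀ x y {z} → q ∣ toList x *ₚ toList y +ₚ toList z → x · y ≡ z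
  ·-unique x y {z} q∣xy+z = ∣x+y⇒x≡y (x · y) z 
    (∣-cancel {q} {toList (x · y)} {toList x *ₚ toList y} {toList z} (·-spec x y) q∣xy+z)

  ·-comm : ∀ x y → x · y ≡ y · x
  ·-comm x y = ·-unique x y (∣ʳ-respʳ-≈
    {x = q} {toList y *ₚ toList x +ₚ toList (y · x)} {toList x *ₚ toList y +ₚ toList (y · x)}
    (+ₚ-cong {toList y *ₚ toList x} {toList x *ₚ toList y} {toList (y · x)}
      (*ₚ-comm (toList y) (toList x)) (λ _ → refl))
    (·-spec y x))

  ·-distribˡ--F : ∀ x y z → x · (y -F z) ≡ (x · y) -F (x · z)
  ·-distribˡ--F x y z = ·-unique x (y -F z) (subst₂ (λ f g → q ∣ toList x *ₚ f +ₚ g)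
    (sym (toList--F y z)) (sym (toList--F (x · y) (x · z)))
    (∣-+-distrib (toList x) (·-spec x y) (·-spec x z)))

  ·-zeroʳ : ∀ x → x · 0F ≡ 0F
  ·-zeroʳ x = begin
    x · 0F              ≡⟨ cong (x ·_) (x-Fx≡0F 0F) ⟨
    x · (0F -F 0F)      ≡⟨ ·-distribˡ--F x 0F 0F ⟩
    (x · 0F) -F (x · 0F)  ≡⟨ x-Fx≡0F (x · 0F) ⟩
    0F                  ∎
    where open ≡-Reasoning

  ·-zeroˡ : ∀ x → 0F · x ≡ 0F
  ·-zeroˡ x = trans (·-comm 0F x) (·-zeroʳ x)

  -- A zero field product means that `q` divides the polynomial product. As `x` is nonzero of degree
  -- less than `k`, `euclid` removes it, and `y` is a multiple of `q` of too small a degree to be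
  -- nonzero.
  x·y≡0⇒y≡0 : ∀ {x} y → x ≢ 0F → x · y ≡ 0F → y ≡ 0F
  x·y≡0⇒y≡0 {x} y x≢0 xy≡0 with ≢0F⇒HasDegree x x≢0
  ... | d , hx = toList≈0⇒≡0F y (∣∧small⇒≈0 {q} {toList y} hq
    (euclid hq irr {d} {toList x} (degree< x hx) hx (∣ʳ-respʳ-≈
      {x = q} {toList x *ₚ toList y +ₚ toList (x · y)} {toList x *ₚ toList y}
      (λ i → trans (coeff-+ₚ (toList x *ₚ toList y) (toList (x · y)) i)
        (trans (cong (coeff (toList x *ₚ toList y) i xor_)
            (trans (cong (λ w → coeff (toList w) i) xy≡0) (toList-0F {k} i)))
          (xor-identityʳ _)))
      (·-spec x y)))
    (coeff-toList-≥ y))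

  ·-injectiveʳ : ∀ {x} → x ≢ 0F → Injective _≡_ _≡_ (x ·_)
  ·-injectiveʳ {x} x≢0 {y} {z} xy≡xz = x-Fy≡0F⇒x≡y y z (x·y≡0⇒y≡0 (y -F z) x≢0 (begin
    x · (y -F z)          ≡⟨ ·-distribˡ--F x y z ⟩
    (x · y) -F (x · z)    ≡⟨ cong (_-F (x · z)) xy≡xz ⟩
    (x · z) -F (x · z)    ≡⟨ x-Fx≡0F (x · z) ⟩
    0F                    ∎))
    where open ≡-Reasoning

  ·-injectiveˡ : ∀ {x} → x ≢ 0F → Injective _≡_ _≡_ (_· x)
  ·-injectiveˡ {x} x≢0 {y} {z} yx≡zx =
    ·-injectiveʳ x≢0 (trans (·-comm x y) (trans yx≡zx (·-comm z x)))

  -- Quotients are used only through their equations; the finite search that finds them stays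
  -- folded.
  abstract
    leftDivide : ∀ {x} → x ≢ 0F → ∀ y → ∃ λ z → x · z ≡ y
    leftDivide x≢0 = injective⇒surjective (bits↔ k) (·-injectiveʳ x≢0)

    rightDivide : ∀ {x} → x ≢ 0F → ∀ y → ∃ λ z → z · x ≡ y
    rightDivide x≢0 = injective⇒surjective (bits↔ k) (·-injectiveˡ x≢0)

  ·-↔ : ∀ {x} → x ≢ 0F → GF k ↔ GF k
  ·-↔ {x} x≢0 = mk↔ₛ′ (x ·_) (proj₁ ∘ leftDivide x≢0) (proj₂ ∘ leftDivide x≢0)
    λ y → ·-injectiveʳ x≢0 (proj₂ (leftDivide x≢0 (x · y)))

-- Rounds under replacement of players

module _ {T : Tournament k A} where

  -- The smaller of two distinct rounds would contradict the minimality of the larger. This allows a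
  -- degree to be read off from a round.
  v-unique : ∀ {x y i j} → v⟨ T ⟩ x , y ≐ i → v⟨ T ⟩ x , y ≐ j → i ≡ j
  v-unique {i = i} {j} (1≤i , _ , same-i , first-i) (1≤j , _ , same-j , first-j) with <-cmp i j
  ... | tri< i<j _ _ = contradiction same-i (first-j i 1≤i i<j)
  ... | tri≈ _ i≡j _ = i≡j
  ... | tri> _ _ j<i = contradiction same-j (first-i j 1≤j j<i)

  -- The leaf of `x` in `T` carries `f x` in `T′`, and a player has only one leaf there. As rounds
  -- depend on positions alone, they transfer as well.
  position-Replaced : ∀ {T′ : Tournament k A} {f} → Replaced f T T′ →
    ∀ x → position T′ (f x) ≡ position T x
  position-Replaced {T′} {f} T′≗fT x = cong toℕ (Inverse.inverseʳ (seeding T′) (begin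
    f x                                      ≡⟨ cong f (Inverse.strictlyInverseˡ (seeding T) x) ⟨
    f (leaf T (Inverse.from (seeding T) x))  ≡⟨ T′≗fT (Inverse.from (seeding T) x) ⟨
    leaf T′ (Inverse.from (seeding T) x)     ∎))
    where open ≡-Reasoning

  v-Replaced : ∀ {T′ : Tournament k A} {f} → Replaced f T T′ →
    ∀ {x y i} → v⟨ T ⟩ x , y ≐ i → v⟨ T′ ⟩ f x , f y ≐ i
  v-Replaced {T′} {f} T′≗fT {x} {y} v
    rewrite position-Replaced {T′} {f} T′≗fT x | position-Replaced {T′} {f} T′≗fT y = v

-- Counting the tournaments T(z)

module Multiples {k q} (hq : HasDegree q k) (irr : Irreducible q) (T : Tournament k (GF k)) where

  open GaloisField hq irr

  multiple : ∀ {z} → z ≢ 0F → Tournament k (GF k)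
  multiple z≢0 = record { seeding = ↔-trans (seeding T) (·-↔ z≢0) }

  #-multiples : ∀ {𝒯 : Pred (Tournament k (GF k)) ℓ} {c}
    (z : Fin c → GF k) (z≢0 : ∀ j → z j ≢ 0F) →
    Injective _≡_ _≡_ z → (∀ j → 𝒯 (multiple (z≢0 j))) →
    (∀ T′ → 𝒯 T′ → ∃ λ j → Replaced (z j ·_) T T′) → # 𝒯 ≐ c
  #-multiples z z≢0 z-inj sound complete = record
    { to        = λ j → multiple (z≢0 j) , sound j
    ; cong      = λ { refl p → refl }
    ; bijective =
        -- Equal seedings agree at every leaf. At the leaf of the nonzero player `z i` they give
        -- `z i · z i ≡ z j · z i`, where the right factor cancels.
        (λ {i} {j} zᵢT≗zⱼT → z-inj (·-injectiveˡ (z≢0 i)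
          (subst (λ x → z i · x ≡ z j · x) (Inverse.strictlyInverseˡ (seeding T) (z i))
            (zᵢT≗zⱼT (Inverse.from (seeding T) (z i))))))
      , λ (T′ , T′∈𝒯) → let j , T′≗zⱼT = complete T′ T′∈𝒯 in
          j , λ { refl p → sym (T′≗zⱼT p) }
    }

  skc : SKC (multiples q T)
  skc = #-multiples elem sound injective
    (λ j → elem j , sound j , λ p → refl)
    (λ T′ (z , z≢0 , T′≗zT) → let j , zⱼ≡z = complete z z≢0 in
      j , λ p → trans (T′≗zT p) (cong (_· leaf T p) (sym zⱼ≡z)))
    where open Enumeration (enumerate-≢ (bits↔ k) 0F)

  module _ (v-T : (x y : GF k) → x ≢ y → ∀ d →
              HasDegree (toList (x -F y)) d → v⟨ T ⟩ x , y ≐ suc d) where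

    -- The players `y` and `y′` stand in `T` where `x` and `x′` stand in `T′`, and cancelling `z`
    -- identifies `w` with their difference. `w` is given by an equation because callers obtain it
    -- differently: either `z` is found from `w`, or `w` from `z`.
    v-multiple : ∀ {T′ z w x x′ d} → z ≢ 0F → Replaced (z ·_) T T′ →
      x ≢ x′ → z · w ≡ x -F x′ →
      HasDegree (toList w) d → v⟨ T′ ⟩ x , x′ ≐ suc d
    v-multiple {T′} {z} {w} {x} {x′} {d} z≢0 T′≗zT x≢x′ zw≡x-x′ hw =
      subst₂ (λ x x′ → v⟨ T′ ⟩ x , x′ ≐ suc d) zy≡x zy′≡x′
        (v-Replaced {T = T} {T′} {z ·_} T′≗zT {y} {y′}
          (v-T y y′ y≢y′ d (subst (λ w → HasDegree (toList w) d) w≡y-y′ hw)))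
      where
      open ≡-Reasoning
      y = proj₁ (leftDivide z≢0 x)
      y′ = proj₁ (leftDivide z≢0 x′)
      zy≡x = proj₂ (leftDivide z≢0 x)
      zy′≡x′ = proj₂ (leftDivide z≢0 x′)
      y≢y′ : y ≢ y′
      y≢y′ y≡y′ = x≢x′ (trans (sym zy≡x) (trans (cong (z ·_) y≡y′) zy′≡x′))
      w≡y-y′ : w ≡ y -F y′
      w≡y-y′ = ·-injectiveʳ z≢0 (begin
        z · w               ≡⟨ zw≡x-x′ ⟩
        x -F x′             ≡⟨ cong₂ _-F_ zy≡x zy′≡x′ ⟨
        (z · y) -F (z · y′) ≡⟨ ·-distribˡ--F z y y′ ⟨
        z · (y -F y′)       ∎)

    -- Converse of `v-multiple`: `w` is nonzero because `x` and `x′` differ, so it has some degree;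
    -- that degree determines the round, and rounds are unique.
    HasDegree-quotient : ∀ {T′ z w x x′ d} → z ≢ 0F → Replaced (z ·_) T T′ →
      x ≢ x′ → z · w ≡ x -F x′ →
      v⟨ T′ ⟩ x , x′ ≐ suc d → HasDegree (toList w) d
    HasDegree-quotient {T′} {z} {w} {x} {x′} {d} z≢0 T′≗zT x≢x′ zw≡x-x′ v =
      subst (HasDegree (toList w)) (suc-injective e+1≡d+1) (proj₂ degree)
      where
      w≢0 : w ≢ 0F
      w≢0 w≡0 = x≢x′ (x-Fy≡0F⇒x≡y x x′
        (trans (sym zw≡x-x′) (trans (cong (z ·_) w≡0) (·-zeroʳ z))))
      degree = ≢0F⇒HasDegree w w≢0
      e+1≡d+1 : suc (proj₁ degree) ≡ suc d
      e+1≡d+1 = v-unique {T = T′} {x} {x′}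
        (v-multiple {T′} {z} {w} z≢0 T′≗zT x≢x′ zw≡x-x′ (proj₂ degree)) v

    stable : Stable (multiples q T)
    -- Round `suc d` belongs to degree `d`, and the bound `suc d ≤ k` on the round is `d < k`.
    stable (suc d) _ d<k = 2 ^ d , count
      where
      open Enumeration (enumerate-HasDegree d<k)
      count : ∀ x x′ → x ≢ x′ →
        # (λ T′ → multiples q T T′ × v⟨ T′ ⟩ x , x′ ≐ suc d) ≐ (2 ^ d)
      count x x′ x≢x′ = #-multiples z z≢0 z-inj
        (λ j → (z j , z≢0 j , λ p → refl) ,
          v-multiple {multiple (z≢0 j)} (z≢0 j) (λ p → refl) x≢x′ (zw≡u j) (sound j))
        complete-z
        where
        u = x -F x′
        u≢0 : u ≢ 0F
        u≢0 u≡0 = x≢x′ (x-Fy≡0F⇒x≡y x x′ u≡0)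

        w≢0 : ∀ j → elem j ≢ 0F
        w≢0 j wⱼ≡0 = HasDegree⇒≉0 {toList (elem j)} (sound j)
          (λ i → trans (cong (λ w → coeff (toList w) i) wⱼ≡0) (toList-0F {k} i))

        -- The list runs over the `w` of degree `d`; the multiplier belonging to `w` is the quotient
        -- of `u` by `w`.
        z : Fin (2 ^ d) → GF k
        z j = proj₁ (rightDivide (w≢0 j) u)

        zw≡u : ∀ j → z j · elem j ≡ u
        zw≡u j = proj₂ (rightDivide (w≢0 j) u)

        z≢0 : ∀ j → z j ≢ 0F
        z≢0 j zⱼ≡0 = u≢0 (trans (sym (zw≡u j))
          (trans (cong (_· elem j) zⱼ≡0) (·-zeroˡ (elem j))))

        z-inj : Injective _≡_ _≡_ z
        -- `z i` times `elem i` and `z i` times `elem j` are both `u`, so `z i` cancels.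
        z-inj {i} {j} zᵢ≡zⱼ = injective (·-injectiveʳ (z≢0 i)
          (trans (zw≡u i) (trans (sym (zw≡u j)) (cong (_· elem j) (sym zᵢ≡zⱼ)))))

        complete-z : ∀ T′ → multiples q T T′ × v⟨ T′ ⟩ x , x′ ≐ suc d →
          ∃ λ j → Replaced (z j ·_) T T′
        -- The quotient `w` of `u` by `y` has degree `d`, hence is some `elem j`. Then `y` and `z j`
        -- both take `elem j` to `u`, so they are equal.
        complete-z T′ ((y , y≢0 , T′≗yT) , v) = j , λ p →
          trans (T′≗yT p) (cong (_· leaf T p) (·-injectiveˡ (w≢0 j) {y} {z j} (begin
            y · elem j    ≡⟨ cong (y ·_) (proj₂ found) ⟩
            y · w         ≡⟨ yw≡u ⟩
            u             ≡⟨ zw≡u j ⟨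
            z j · elem j  ∎)))
          where
          open ≡-Reasoning
          w = proj₁ (leftDivide y≢0 u)
          yw≡u = proj₂ (leftDivide y≢0 u)
          found = complete w (HasDegree-quotient {T′} {y} {w} y≢0 T′≗yT x≢x′ yw≡u v)
          j = proj₁ found

theorem3p1 : (k : ℕ) → 2 ≤ k →
    (q : Poly) → HasDegree q k → Irreducible q →
    (T : Tournament k (GF k)) →
    ((x y : GF k) → x ≢ y → ∀ d → HasDegree (toList (x -F y)) d → v⟨ T ⟩ x , y ≐ suc d) →
    SKC (multiples q T) × Stable (multiples q T)
theorem3p1 k _ q hq irr T v-T = Multiples.skc hq irr T , Multiples.stable hq irr T v-T
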